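{- Let $h \geq 3$ be an integer and let $A = \{a_1, \ldots, a_{h+1}\}$ be a set of positive integers with $a_1 < \cdots < a_{h+1}$. Then \[|h^{\wedge}_{\pm}A| \geq h^2 + 2h + 1.\] This lower bound is best possible: for every $h \geq 3$ there is a set $A$ of $h+1$ positive integers with $|h^{\wedge}_{\pm}A| = h^2 + 2h + 1$.
   Context: For a finite set $A = \{a_1, \ldots, a_k\}$ of integers (with distinct $a_i$) and a positive integer $h$, the restricted $h$-fold signed sumset is \[h^{\wedge}_{\pm}A = \left\{ \sum_{i=1}^{k} \lambda_i a_i : \lambda_i \in \{ -1,0,1\}, \ \sum_{i=1}^{k} |\lambda_i| = h \right\}.\] -}

module Defs where

open import Data.Nat using (ℕ; zero; suc)
open import Data.Integer using (ℤ; +_; _+_; _*_; -[1+_])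
open import Data.Integer.Properties using (_≟_)
import Data.Nat as N
import Data.Nat.Properties as NP
open import Data.List using (List; []; _∷_; map; concatMap; filter; length; deduplicate)
open import Data.Vec using (Vec; []; _∷_)

data Sign : Set where
  neg zer pos : Sign

coef : Sign → ℤ
coef neg = -[1+ 0 ]
coef zer = + 0
coef pos = + 1

absS : Sign → ℕ
absS zer = 0
absS neg = 1
absS pos = 1

allSigns : (k : ℕ) → List (Vec Sign k)
allSigns zero = [] ∷ []
allSigns (suc k) = concatMap (λ v → (neg ∷ v) ∷ (zer ∷ v) ∷ (pos ∷ v) ∷ []) (allSigns k)

weight : ∀ {k} → Vec Sign k → ℕ
weight [] = 0
weight (s ∷ v) = absS s N.+ weight v

signedSum : ∀ {k} → Vec Sign k → Vec ℤ k → ℤ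
signedSum [] [] = + 0
signedSum (s ∷ v) (a ∷ as) = coef s * a + signedSum v as

-- restricted h-fold signed sumset h^∧_± A, as a list (possibly with repetitions)
restrictedSignedSumset : ∀ {k} → ℕ → Vec ℤ k → List ℤ
restrictedSignedSumset h A =
  map (λ v → signedSum v A) (filter (λ v → weight v NP.≟ h) (allSigns _))

card : List ℤ → ℕ
card xs = length (deduplicate _≟_ xs)

{-# OPTIONS --safe #-}
module Submission where

-- Put n = h + 1 and let T be the sum of A.  Adding T to the signed sums turns them into the
-- numbers a + 2 σ, where a ∈ A and σ is a subset sum of A without a; n² of these are needed.
-- Induct on n by removing the maximum m of A.  With e the minimum and T′ the sum of the others,
-- their numbers lie in [e , 2 T′ - e] and remain available, and the reflection x ↦ 2 T - x
-- sends those numbers of A that are below 2 m + e to numbers above 2 T′ - e.  So it suffices to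
-- find 2 n - 1 numbers in this window.  The n elements of A are some of them.  A further n - 1
-- are m + 2 x if 2 x < m + e and e + 2 x otherwise, for x ∈ A other than m, unless two of
-- these coincide.  A coincidence gives m = e + 2 D with u and w = u + D in A, and then for each x
-- one of x + 2 u and x + 2 w lies in [m + 2 e , 2 m + e); these are distinct, and all but at most
-- one are admissible.  The lost one is replaced by some x + 2 e that is not in A, and if there
-- is none then A without e is a progression of step 2 e, where a replacement can be written
-- down except for A = {e , 3 e , 5 e}.  That set has only 8 numbers, but its extensions have 16.
-- For the odd numbers 1 , 3 , … , 2 n - 1 all signed sums have the same parity and lie between
-- 1 - n² and n² - 1, so there are at most n² of them.

open import Defs
open import Algebra.Properties.AbelianGroup using (∙-cancelʳ)
open import Data.Nat using (ℕ; zero; suc; _≤_; _<_; _+_; _*_; _∸_; z≤n; s≤s; _≤?_; _<?_; _≟_; NonZero; >-nonZero)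
open import Data.Nat.DivMod using (_/_; _%_; m≡m%n+[m/n]*n; m%n<n)
open import Data.Nat.ListAction using (sum)
open import Data.Nat.ListAction.Properties using (sum-++)
open import Data.Nat.Properties hiding (_≟_; _≤?_; _<?_)
open import Data.Nat.Tactic.RingSolver using (solve)
open import Data.Integer as ℤ using (ℤ; +_; -[1+_]; +<+; ∣_∣) renaming (_<_ to _<ℤ_)
import Data.Integer.Properties as ℤ
import Data.Integer.Tactic.RingSolver as ℤ-RingSolver
open import Data.Fin as Fin using (Fin; toℕ) renaming (_<_ to _<F_)
open import Data.Vec using (Vec; []; _∷_; lookup) renaming (tabulate to tabulateᵛ)
open import Data.Vec.Properties using (lookup∘tabulate)
open import Data.List using (List; []; _∷_; [_]; _++_; _∷ʳ_; map; length; tabulate; upTo)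
open import Data.List.Properties using (length-++; length-map; length-upTo; length-tabulate; tabulate-cong)
open import Data.List.Reverse using (Reverse; []; _∶_∶ʳ_; reverseView)
open import Data.List.Membership.Propositional using (_∈_; _∉_; find; lose)
open import Data.List.Membership.Propositional.Properties
open import Data.List.Membership.DecPropositional _≟_ using (_∈?_)
open import Data.List.Relation.Unary.Any as Any using (here; there; any?)
open import Data.List.Relation.Unary.All as All using (All; []; _∷_; all?)
import Data.List.Relation.Unary.All.Properties as All
open import Data.List.Relation.Unary.AllPairs as AllPairs using (AllPairs; []; _∷_)
import Data.List.Relation.Unary.AllPairs.Properties as AllPairs
open import Data.List.Relation.Unary.Unique.Propositional using (Unique)
import Data.List.Relation.Unary.Unique.Propositional.Properties as Unique
open import Data.List.Relation.Unary.Unique.DecPropositional _≟_ using (unique?)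
open import Data.List.Relation.Unary.Unique.DecPropositional.Properties ℤ._≟_ using (deduplicate-!)
open import Data.Product using (_×_; _,_; ∃; proj₁; proj₂)
open import Data.Sum using (_⊎_; inj₁; inj₂; [_,_]′)
open import Function using (_∘_; id)
open import Relation.Nullary using (¬_; Dec; yes; no; contradiction)
open import Relation.Nullary.Decidable using (_⊎-dec_; _→-dec_; from-yes)
open import Relation.Binary.PropositionalEquality using (_≡_; _≢_; refl; sym; trans; cong; cong₂; subst; subst₂)

private variable
  A B : Set

-- Fixes the type of the variable lists given to the ring solver, where _∷_ is overloaded.
vars : List ℕ → List ℕ
vars xs = xs

-- Counting distinct elements of a predicate.

-- A lower bound on a cardinality, carried by an explicit duplicate-free list; such bounds add over
-- disjoint predicates and transfer along injections.
record AtLeast (n : ℕ) (P : A → Set) : Set where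
  constructor atLeast
  field
    members  : List A
    distinct : Unique members
    satisfy  : All P members
    enough   : n ≤ length members

atLeast-∈ : {xs : List A} → Unique xs → AtLeast (length xs) (_∈ xs)
atLeast-∈ {xs = xs} xs! = atLeast xs xs! (All.tabulate id) ≤-refl

atLeast-∪ : ∀ {m n} {P Q R : A → Set} → (∀ {x} → P x → R x) → (∀ {x} → Q x → R x) →
            (∀ {x} → P x → ¬ Q x) → AtLeast m P → AtLeast n Q → AtLeast (m + n) R
atLeast-∪ P⊆R Q⊆R P∩Q≡∅ (atLeast xs xs! pxs m≤) (atLeast ys ys! qys n≤) =
  atLeast (xs ++ ys)
    (Unique.++⁺ xs! ys! (λ (∈xs , ∈ys) → P∩Q≡∅ (All.lookup pxs ∈xs) (All.lookup qys ∈ys)))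
    (All.++⁺ (All.map P⊆R pxs) (All.map Q⊆R qys))
    (≤-trans (+-mono-≤ m≤ n≤) (≤-reflexive (sym (length-++ xs))))

unique-map : ∀ {P : A → Set} (f : A → B) → (∀ {x y} → P x → P y → f x ≡ f y → x ≡ y) →
             ∀ {xs} → All P xs → Unique xs → Unique (map f xs)
unique-map f inj []         []           = []
unique-map f inj (px ∷ pxs) (x∉xs ∷ xs!) =
  All.map⁺ (All.zipWith (λ (py , x≢y) → x≢y ∘ inj px py) (pxs , x∉xs)) ∷ unique-map f inj pxs xs!

atLeast-map : ∀ {n} {P : A → Set} {Q : B → Set} (f : A → B) → (∀ {x} → P x → Q (f x)) →
              (∀ {x y} → P x → P y → f x ≡ f y → x ≡ y) → AtLeast n P → AtLeast n Q
atLeast-map f P⇒Q inj (atLeast xs xs! pxs n≤) =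
  atLeast (map f xs) (unique-map f inj pxs xs!) (All.map⁺ (All.map P⇒Q pxs))
    (≤-trans n≤ (≤-reflexive (sym (length-map f xs))))

-- Pigeonhole: one occurrence of the head is cut out of `ys`, and the tail still embeds into the
-- rest.
unique-⊆⇒length-≤ : {xs ys : List A} → Unique xs → (∀ {x} → x ∈ xs → x ∈ ys) → length xs ≤ length ys
unique-⊆⇒length-≤ {xs = []}     _            _  = z≤n
unique-⊆⇒length-≤ {xs = x ∷ xs} (x∉xs ∷ xs!) xs⊆ys with ∈-∃++ (xs⊆ys (here refl))
... | ps , qs , refl = ≤-trans (s≤s (unique-⊆⇒length-≤ xs! avoid)) (≤-reflexive length-split)
  where
  avoid : ∀ {y} → y ∈ xs → y ∈ ps ++ qs
  avoid y∈xs with ∈-++⁻ ps (xs⊆ys (there y∈xs))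
  ... | inj₁ y∈ps         = ∈-++⁺ˡ y∈ps
  ... | inj₂ (here refl)  = contradiction refl (All.lookup x∉xs y∈xs)
  ... | inj₂ (there y∈qs) = ∈-++⁺ʳ ps y∈qs
  length-split : suc (length (ps ++ qs)) ≡ length (ps ++ x ∷ qs)
  length-split rewrite length-++ ps {qs} | length-++ ps {x ∷ qs} = sym (+-suc (length ps) (length qs))

-- Adding l ≤ r to the goal turns it into a semiring identity.
linear : ∀ {l r p q} → l ≤ r → p + r ≡ q + l → p ≤ q
linear {l} {r} {p} {q} l≤r eq =
  +-cancelʳ-≤ r p q (≤-trans (≤-reflexive eq) (+-monoʳ-≤ q l≤r))

linear-≡ : ∀ {l r p q} → l ≡ r → p + r ≡ q + l → p ≡ q
linear-≡ {l} {p = p} {q} refl eq = +-cancelʳ-≡ l p q eq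

-- Adds equations, so that several of them can enter `linear-≡` as one.
_⊕_ : ∀ {k l m n : ℕ} → k ≡ l → m ≡ n → k + m ≡ l + n
refl ⊕ refl = refl

-- Subset sums, sums with one omitted entry, and their reflection.

-- Twice a subset sum: the signed sum with all signs nonzero, shifted by the total of the list.
data Full : List ℕ → ℕ → Set where
  []   : Full [] 0
  skip : ∀ {x xs y} → Full xs y → Full (x ∷ xs) y
  take : ∀ {x xs y} → Full xs y → Full (x ∷ xs) (2 * x + y)

-- OneOmitted xs y says y = a + 2 σ with a ∈ xs and σ a subset sum of the other entries:
-- y - sum xs is the signed sum that omits a and gives the sign + to that subset.
data OneOmitted : List ℕ → ℕ → Set where
  omit : ∀ {x xs y} → Full xs y → OneOmitted (x ∷ xs) (x + y)
  skip : ∀ {x xs y} → OneOmitted xs y → OneOmitted (x ∷ xs) y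
  take : ∀ {x xs y} → OneOmitted xs y → OneOmitted (x ∷ xs) (2 * x + y)

full-0 : ∀ xs → Full xs 0
full-0 []       = []
full-0 (x ∷ xs) = skip (full-0 xs)

full-single : ∀ {x xs} → x ∈ xs → Full xs (2 * x)
full-single {xs = x ∷ xs} (here refl) = subst (Full _) (+-identityʳ (2 * x)) (take (full-0 xs))
full-single (there x∈xs) = skip (full-single x∈xs)

oneOmitted-single : ∀ {x xs} → x ∈ xs → OneOmitted xs x
oneOmitted-single {xs = x ∷ xs} (here refl) = subst (OneOmitted _) (+-identityʳ x) (omit (full-0 xs))
oneOmitted-single (there x∈xs) = skip (oneOmitted-single x∈xs)

oneOmitted-pair : ∀ {x y xs} → x ∈ xs → y ∈ xs → x ≢ y → OneOmitted xs (x + 2 * y)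
oneOmitted-pair (here refl)  (here refl)  x≢y = contradiction refl x≢y
oneOmitted-pair (here refl)  (there y∈xs) x≢y = omit (full-single y∈xs)
oneOmitted-pair {x} {y} (there x∈xs) (here refl) x≢y =
  subst (OneOmitted _) (+-comm (2 * y) x) (take (oneOmitted-single x∈xs))
oneOmitted-pair (there x∈xs) (there y∈xs) x≢y = skip (oneOmitted-pair x∈xs y∈xs x≢y)

reflect-step : ∀ x y z s a b → a + b ≡ 2 * x → y + z ≡ 2 * s → (a + y) + (b + z) ≡ 2 * (x + s)
reflect-step x y z s a b p q = linear-≡ (p ⊕ q) (solve (vars (x ∷ y ∷ z ∷ s ∷ a ∷ b ∷ [])))

double : ∀ x → x + x ≡ 2 * x
double x = solve (vars (x ∷ []))

-- Swapping `skip` and `take` complements the subset, which negates the signed sum.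
full-reflect : ∀ {xs y} → Full xs y → ∃ λ z → Full xs z × y + z ≡ 2 * sum xs
full-reflect [] = 0 , [] , refl
full-reflect (skip {x} f) with full-reflect f
... | z , g , eq = 2 * x + z , take g , reflect-step x _ z _ 0 (2 * x) refl eq
full-reflect (take {x} f) with full-reflect f
... | z , g , eq = z , skip g , reflect-step x _ z _ (2 * x) 0 (+-identityʳ (2 * x)) eq

oneOmitted-reflect′ : ∀ {xs y} → OneOmitted xs y → ∃ λ z → OneOmitted xs z × y + z ≡ 2 * sum xs
-- The omitted entry stays omitted and contributes x to both numbers.
oneOmitted-reflect′ (omit {x} f) with full-reflect f
... | z , g , eq = x + z , omit g , reflect-step x _ z _ x x (double x) eq
oneOmitted-reflect′ (skip {x} f) with oneOmitted-reflect′ f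
... | z , g , eq = 2 * x + z , take g , reflect-step x _ z _ 0 (2 * x) refl eq
oneOmitted-reflect′ (take {x} f) with oneOmitted-reflect′ f
... | z , g , eq = z , skip g , reflect-step x _ z _ (2 * x) 0 (+-identityʳ (2 * x)) eq

oneOmitted-≤ : ∀ {xs y} → OneOmitted xs y → y ≤ 2 * sum xs
oneOmitted-≤ {y = y} f with oneOmitted-reflect′ f
... | z , _ , eq = ≤-trans (m≤m+n y z) (≤-reflexive eq)

oneOmitted-reflect : ∀ {xs y} → OneOmitted xs y → OneOmitted xs (2 * sum xs ∸ y)
oneOmitted-reflect {y = y} f with oneOmitted-reflect′ f
... | z , g , eq = subst (OneOmitted _) (trans (sym (m+n∸m≡n y z)) (cong (_∸ y) eq)) g

oneOmitted-≥ : ∀ {e xs y} → All (e ≤_) xs → OneOmitted xs y → e ≤ y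
oneOmitted-≥ (e≤x ∷ _) (omit {x} {y = y} _) = ≤-trans e≤x (m≤m+n x y)
oneOmitted-≥ (_ ∷ e≤xs) (skip f) = oneOmitted-≥ e≤xs f
oneOmitted-≥ (_ ∷ e≤xs) (take {x} {y = y} f) = ≤-trans (oneOmitted-≥ e≤xs f) (m≤n+m y (2 * x))

full-∷ʳ : ∀ {xs y} m → Full xs y → Full (xs ∷ʳ m) y
full-∷ʳ m []       = skip []
full-∷ʳ m (skip f) = skip (full-∷ʳ m f)
full-∷ʳ m (take f) = take (full-∷ʳ m f)

oneOmitted-∷ʳ : ∀ {xs y} m → OneOmitted xs y → OneOmitted (xs ∷ʳ m) y
oneOmitted-∷ʳ m (omit f) = omit (full-∷ʳ m f)
oneOmitted-∷ʳ m (skip f) = skip (oneOmitted-∷ʳ m f)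
oneOmitted-∷ʳ m (take f) = take (oneOmitted-∷ʳ m f)

-- Appending a new maximum.

Window : ℕ → List ℕ → ℕ → ℕ → Set
Window e ys m z = OneOmitted (ys ∷ʳ m) z × z < 2 * m + e

-- Reflection carries the window above 2 * sum ys ∸ e, the maximum of OneOmitted ys.
atLeast-extend : ∀ {e ys m a b} → All (e ≤_) ys → AtLeast a (OneOmitted ys) →
                 AtLeast b (Window e ys m) → AtLeast (a + b) (OneOmitted (ys ∷ʳ m))
atLeast-extend {e} {ys} {m} e≤ys small window =
  atLeast-∪ (oneOmitted-∷ʳ m) proj₁ disjoint small
    (atLeast-map {P = Window e ys m} {Q = Large} (S ∸_) reflect inj window)
  where
  S = 2 * sum (ys ∷ʳ m)
  Large : ℕ → Set
  -- This is 2 * sum ys - e < z, written without truncated subtraction.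
  Large z = OneOmitted (ys ∷ʳ m) z × 2 * sum ys < e + z
  S≡ : S ≡ 2 * (sum ys + m)
  S≡ = cong (2 *_) (trans (sum-++ ys [ m ]) (cong (λ n → sum ys + n) (+-identityʳ m)))
  reflect : ∀ {z} → Window e ys m z → Large (S ∸ z)
  reflect {z} (f , z<) = oneOmitted-reflect f , above (sum ys) (S ∸ z) z< (trans (m+[n∸m]≡n (oneOmitted-≤ f)) S≡)
    where
    above : ∀ s z′ → z < 2 * m + e → z + z′ ≡ 2 * (s + m) → 2 * s < e + z′
    above s z′ p q = linear (+-mono-≤ p (≤-reflexive (sym q))) (solve (vars (s ∷ z′ ∷ z ∷ m ∷ e ∷ [])))
  inj : ∀ {x y} → Window e ys m x → Window e ys m y → S ∸ x ≡ S ∸ y → x ≡ y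
  inj (f , _) (g , _) eq =
    trans (sym (m∸[m∸n]≡n (oneOmitted-≤ f))) (trans (cong (S ∸_) eq) (m∸[m∸n]≡n (oneOmitted-≤ g)))
  disjoint : ∀ {x} → OneOmitted ys x → ¬ Large x
  -- Reflection inside `ys` turns the lower bound e into the upper bound 2 * sum ys - e.
  disjoint {x} f (_ , large) with oneOmitted-reflect′ f
  ... | z , g , eq = <⇒≱ large (below (sum ys) z (oneOmitted-≥ e≤ys g) eq)
    where
    below : ∀ s z → e ≤ z → x + z ≡ 2 * s → e + x ≤ 2 * s
    below s z p q = linear (+-mono-≤ p (≤-reflexive q)) (solve (vars (s ∷ z ∷ x ∷ e ∷ [])))

-- Finding enough numbers in the window.

module _ {e m : ℕ} {ys : List ℕ} (0<e : 0 < e) (e∈ys : e ∈ ys) (e≤ : ∀ {x} → x ∈ ys → e ≤ x)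
         (<m : ∀ {x} → x ∈ ys → x < m) (ys! : Unique ys) where

  private
    xs = ys ∷ʳ m

    m∈xs : m ∈ xs
    m∈xs = ∈-++⁺ʳ ys (here refl)

    e∈xs : e ∈ xs
    e∈xs = ∈-++⁺ˡ e∈ys

    e<m : e < m
    e<m = <m e∈ys

    ≤m : ∀ {x} → x ∈ xs → x ≤ m
    ≤m x∈xs with ∈-++⁻ ys x∈xs
    ... | inj₁ x∈ys        = <⇒≤ (<m x∈ys)
    ... | inj₂ (here refl) = ≤-refl

    ∈ys : ∀ {x} → x ∈ xs → x ≢ m → x ∈ ys
    ∈ys x∈xs x≢m with ∈-++⁻ ys x∈xs
    ... | inj₁ x∈ys        = x∈ys
    ... | inj₂ (here refl) = contradiction refl x≢m

    xs! : Unique xs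
    xs! = Unique.++⁺ ys! ([] ∷ []) λ { (x∈ys , here refl) → <-irrefl refl (<m x∈ys) }

    -- With n = length xs this asks for 2 n - 1 numbers, the difference of n² and (n - 1)².
    Counted = AtLeast (length xs + length ys) (Window e ys m)

  -- The entries of `xs` lie in the window themselves; an injective family indexed by `ys` that
  -- avoids them supplies the rest.
  window-count : (g : ℕ → ℕ) → (∀ {x} → x ∈ ys → Window e ys m (g x)) → (∀ {x} → x ∈ ys → g x ∉ xs) →
                 (∀ {x y} → x ∈ ys → y ∈ ys → g x ≡ g y → x ≡ y) → Counted
  window-count g in-window g∉xs g-inj =
    atLeast-∪ {P = _∈ xs} {Q = λ z → Window e ys m z × z ∉ xs}
      (λ {x} x∈xs → oneOmitted-single x∈xs , small x (≤m x∈xs))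
      proj₁ (λ x∈xs (_ , x∉xs) → x∉xs x∈xs) (atLeast-∈ xs!)
      (atLeast-map {P = _∈ ys} g (λ x∈ys → in-window x∈ys , g∉xs x∈ys) g-inj (atLeast-∈ ys!))
    where
    small : ∀ x → x ≤ m → x < 2 * m + e
    small x x≤m = linear (+-mono-≤ x≤m (+-mono-≤ (z≤n {m}) 0<e)) (solve (vars (e ∷ m ∷ x ∷ [])))

  >m⇒∉xs : ∀ {x} → m < x → x ∉ xs
  >m⇒∉xs m<x = <⇒≱ m<x ∘ ≤m

  module NoCollision (no-collision : ∀ {i j} → i ∈ ys → j ∈ ys → m + 2 * i ≢ e + 2 * j) where

    -- The threshold is where m + 2 x leaves the window; from there on e + 2 x exceeds m and so is
    -- not an entry.
    g : ℕ → ℕ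
    g x with 2 * x <? m + e
    ... | yes _ = m + 2 * x
    ... | no  _ = e + 2 * x

    g-cases : ∀ x → (2 * x < m + e × g x ≡ m + 2 * x) ⊎ (m + e ≤ 2 * x × g x ≡ e + 2 * x)
    g-cases x with 2 * x <? m + e
    ... | yes p = inj₁ (p , refl)
    ... | no  p = inj₂ (≮⇒≥ p , refl)

    g>m : ∀ {x} → x ∈ ys → m < g x
    g>m {x} x∈ys with g-cases x
    ... | inj₁ (p , eq) rewrite eq =
      linear (+-mono-≤ 0<e (+-mono-≤ (z≤n {x}) (e≤ x∈ys))) (solve (vars (e ∷ m ∷ x ∷ [])))
    ... | inj₂ (p , eq) rewrite eq =
      linear (+-mono-≤ p (+-mono-≤ 0<e (z≤n {e}))) (solve (vars (e ∷ m ∷ x ∷ [])))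

    in-window : ∀ {x} → x ∈ ys → Window e ys m (g x)
    in-window {x} x∈ys with g-cases x
    ... | inj₁ (p , eq) rewrite eq =
      oneOmitted-pair m∈xs (∈-++⁺ˡ x∈ys) (<⇒≢ (<m x∈ys) ∘ sym) ,
      linear p (solve (vars (e ∷ m ∷ x ∷ [])))
    ... | inj₂ (p , eq) rewrite eq =
      oneOmitted-pair e∈xs (∈-++⁺ˡ x∈ys) e≢x ,
      linear (+-mono-≤ (<m x∈ys) (<⇒≤ (<m x∈ys))) (solve (vars (e ∷ m ∷ x ∷ [])))
      where
      e≢x : e ≢ x
      e≢x refl = <⇒≱ e<m (linear p (solve (vars (e ∷ m ∷ []))))

    g-inj : ∀ {x y} → x ∈ ys → y ∈ ys → g x ≡ g y → x ≡ y
    g-inj {x} {y} x∈ys y∈ys eq with g-cases x | g-cases y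
    ... | inj₁ (_ , p) | inj₁ (_ , q) = *-cancelˡ-≡ x y 2 (+-cancelˡ-≡ m _ _ (trans (sym p) (trans eq q)))
    ... | inj₂ (_ , p) | inj₂ (_ , q) = *-cancelˡ-≡ x y 2 (+-cancelˡ-≡ e _ _ (trans (sym p) (trans eq q)))
    ... | inj₁ (_ , p) | inj₂ (_ , q) = contradiction (trans (sym p) (trans eq q)) (no-collision x∈ys y∈ys)
    ... | inj₂ (_ , p) | inj₁ (_ , q) = contradiction (trans (sym q) (trans (sym eq) p)) (no-collision y∈ys x∈ys)

    counted : Counted
    counted = window-count g in-window (>m⇒∉xs ∘ g>m) g-inj

  -- In terms of D, m + 2 e is 3 e + 2 D and 2 m + e is 3 e + 4 D. The interval between them has
  -- length 2 D, which is also the distance between x + 2 u and x + 2 (u + D).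
  module Collision (D u : ℕ) (m≡ : m ≡ e + 2 * D) (u∈ys : u ∈ ys) (w∈ys : u + D ∈ ys) where

    <m′ : ∀ {x} → x ∈ ys → x < e + 2 * D
    <m′ x∈ys = subst (_ <_) m≡ (<m x∈ys)

    window-bound : ∀ {z} → z < 3 * e + 4 * D → z < 2 * m + e
    window-bound {z} = subst (z <_) (linear-≡ (sym m≡ ⊕ sym m≡) (solve (vars (e ∷ m ∷ D ∷ []))) )

    m<3e+2D : m < 3 * e + 2 * D
    m<3e+2D = subst (_< 3 * e + 2 * D) (sym m≡) (linear (+-mono-≤ 0<e (z≤n {e})) (solve (vars (e ∷ D ∷ []))))

    x+2e<3e+2D : ∀ {x} → x ∈ ys → x + 2 * e < 3 * e + 2 * D
    x+2e<3e+2D {x} x∈ys = linear (<m′ x∈ys) (solve (vars (e ∷ D ∷ x ∷ [])))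

    -- Of the two translates x + 2 u and x + 2 u + 2 D, the one lying in [3 e + 2 D , 3 e + 4 D).
    g : ℕ → ℕ
    g x with 3 * e + 2 * D ≤? x + 2 * u
    ... | yes _ = x + 2 * u
    ... | no  _ = x + 2 * (u + D)

    g-cases : ∀ x → (3 * e + 2 * D ≤ x + 2 * u × g x ≡ x + 2 * u) ⊎ (x + 2 * u < 3 * e + 2 * D × g x ≡ x + 2 * (u + D))
    g-cases x with 3 * e + 2 * D ≤? x + 2 * u
    ... | yes p = inj₁ (p , refl)
    ... | no  p = inj₂ (≰⇒> p , refl)

    g≥3e+2D : ∀ {x} → x ∈ ys → 3 * e + 2 * D ≤ g x
    g≥3e+2D {x} x∈ys with g-cases x
    ... | inj₁ (p , eq) rewrite eq = p
    ... | inj₂ (p , eq) rewrite eq =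
      linear (+-mono-≤ (e≤ x∈ys) (+-mono-≤ (e≤ u∈ys) (e≤ u∈ys))) (solve (vars (e ∷ D ∷ u ∷ x ∷ [])))

    g< : ∀ {x} → x ∈ ys → g x < 3 * e + 4 * D
    g< {x} x∈ys with g-cases x
    ... | inj₁ (p , eq) rewrite eq =
      linear (+-mono-≤ (<m′ x∈ys) (+-mono-≤ (<⇒≤ (<m′ w∈ys)) (<⇒≤ (<m′ w∈ys)))) (solve (vars (e ∷ D ∷ u ∷ x ∷ [])))
    ... | inj₂ (p , eq) rewrite eq = linear p (solve (vars (e ∷ D ∷ u ∷ x ∷ [])))

    -- Equality would give x = y + 2 D, which is at least e + 2 D = m.
    residue : ∀ {x y} → x ∈ ys → y ∈ ys → x + 2 * u ≢ y + 2 * (u + D)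
    residue {x} {y} x∈ys y∈ys eq =
      <⇒≱ (<m′ x∈ys) (linear (+-mono-≤ (e≤ y∈ys) (≤-reflexive (sym eq))) (solve (vars (e ∷ D ∷ u ∷ x ∷ y ∷ []))))

    g-inj : ∀ {x y} → x ∈ ys → y ∈ ys → g x ≡ g y → x ≡ y
    g-inj {x} {y} x∈ys y∈ys eq with g-cases x | g-cases y
    ... | inj₁ (_ , p) | inj₁ (_ , q) = +-cancelʳ-≡ _ x y (trans (sym p) (trans eq q))
    ... | inj₂ (_ , p) | inj₂ (_ , q) = +-cancelʳ-≡ _ x y (trans (sym p) (trans eq q))
    ... | inj₁ (_ , p) | inj₂ (_ , q) = contradiction (trans (sym p) (trans eq q)) (residue x∈ys y∈ys)
    ... | inj₂ (_ , p) | inj₁ (_ , q) = contradiction (trans (sym q) (trans (sym eq) p)) (residue y∈ys x∈ys)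

    -- The only x for which g x may use an element of xs twice.
    Bad : ℕ → Set
    Bad b = (u + D + 2 * u < 3 * e + 2 * D × b ≡ u + D) ⊎ (3 * e + 2 * D ≤ u + D + 2 * u × b ≡ u)

    bad : ∃ Bad
    bad with 3 * e + 2 * D ≤? u + D + 2 * u
    ... | yes p = u , inj₂ (p , refl)
    ... | no  p = u + D , inj₁ (≰⇒> p , refl)

    -- An entry is used twice only in u + 2 u, when 3 e + 2 D ≤ 3 u, or in w + 2 w with w = u + D,
    -- when 3 u + D < 3 e + 2 D. These conditions exclude each other, and `Bad` names the element
    -- that remains possible.
    g-oneOmitted : ∀ {b x} → Bad b → x ∈ ys → x ≢ b → OneOmitted xs (g x)
    g-oneOmitted {b} {x} b-bad x∈ys x≢b with g-cases x
    ... | inj₁ (p , eq) rewrite eq = oneOmitted-pair (∈-++⁺ˡ x∈ys) (∈-++⁺ˡ u∈ys) (x≢u b-bad)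
      where
      x≢u : Bad b → x ≢ u
      x≢u (inj₂ (_ , refl)) = x≢b
      x≢u (inj₁ (q , refl)) refl =
        <⇒≱ q (≤-trans p (linear (z≤n {D}) (solve (vars (D ∷ u ∷ [])))))
    ... | inj₂ (p , eq) rewrite eq = oneOmitted-pair (∈-++⁺ˡ x∈ys) (∈-++⁺ˡ w∈ys) (x≢w b-bad)
      where
      x≢w : Bad b → x ≢ u + D
      x≢w (inj₁ (_ , refl)) = x≢b
      x≢w (inj₂ (q , refl)) refl = <⇒≱ p q

    -- All values of `g` exceed m and thus avoid `xs`; only the value at b is exchanged, for a z
    -- that is neither an entry nor another value of `g`.
    replace-bad : ∀ {b z} → Bad b → Window e ys m z → z ∉ xs → (∀ {x} → x ∈ ys → x ≢ b → g x ≢ z) → Counted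
    replace-bad {b} {z} b-bad z-window z∉xs g≢z = window-count g′ in-window g′∉xs g′-inj
      where
      g′ : ℕ → ℕ
      g′ x with x ≟ b
      ... | yes _ = z
      ... | no  _ = g x
      in-window : ∀ {x} → x ∈ ys → Window e ys m (g′ x)
      in-window {x} x∈ys with x ≟ b
      ... | yes _   = z-window
      ... | no  x≢b = g-oneOmitted b-bad x∈ys x≢b , window-bound (g< x∈ys)
      g′∉xs : ∀ {x} → x ∈ ys → g′ x ∉ xs
      g′∉xs {x} x∈ys with x ≟ b
      ... | yes _ = z∉xs
      ... | no  _ = >m⇒∉xs (<-≤-trans m<3e+2D (g≥3e+2D x∈ys))
      g′-inj : ∀ {x y} → x ∈ ys → y ∈ ys → g′ x ≡ g′ y → x ≡ y
      g′-inj {x} {y} x∈ys y∈ys eq with x ≟ b | y ≟ b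
      ... | yes refl | yes refl = refl
      ... | yes _    | no  y≢b  = contradiction (sym eq) (g≢z y∈ys y≢b)
      ... | no  x≢b  | yes _    = contradiction eq (g≢z x∈ys x≢b)
      ... | no  _    | no  _    = g-inj x∈ys y∈ys eq

    -- Every x + 2 e lies below 3 e + 2 D, hence below all values of `g`, so it can serve as the
    -- replacement as soon as it is not an entry.
    missing-step : ∀ {x} → x ∈ ys → x ≢ e → x + 2 * e ∉ xs → Counted
    missing-step {x} x∈ys x≢e x+2e∉xs =
      replace-bad (proj₂ bad)
        (oneOmitted-pair (∈-++⁺ˡ x∈ys) e∈xs x≢e , window-bound (<-≤-trans (x+2e<3e+2D x∈ys) lower≤upper))
        x+2e∉xs (λ y∈ys _ → <⇒≢ (<-≤-trans (x+2e<3e+2D x∈ys) (g≥3e+2D y∈ys)) ∘ sym)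
      where
      lower≤upper : 3 * e + 2 * D ≤ 3 * e + 4 * D
      lower≤upper = linear (z≤n {2 * D}) (solve (vars (e ∷ D ∷ [])))

  -- Together with e ∈ ys this says that the entries are exactly e, 3 e and 5 e.
  Exceptional : Set
  Exceptional = m ≡ 5 * e × 3 * e ∈ xs × (∀ {x} → x ∈ ys → x ≡ e ⊎ x ≡ 3 * e)

  module Closed (closed : ∀ {x} → x ∈ ys → x ≢ e → x + 2 * e ∈ xs) where

    private
      instance
        nonZero : NonZero (2 * e)
        nonZero = >-nonZero (+-mono-≤ 0<e z≤n)

    e<x : ∀ {x} → x ∈ xs → x ≢ e → e < x
    e<x {x} x∈xs x≢e with x ≟ m
    ... | yes refl = e<m
    ... | no x≢m = ≤∧≢⇒< (e≤ (∈ys x∈xs x≢m)) (x≢e ∘ sym)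

    climb : ∀ j {x} → x ∈ xs → x ≢ e → x + j * (2 * e) ≤ m → x + j * (2 * e) ∈ xs
    climb zero    {x} x∈xs x≢e _  = subst (_∈ xs) (sym (+-identityʳ x)) x∈xs
    climb (suc j) {x} x∈xs x≢e p≤m = subst (_∈ xs) step (closed (∈ys q∈xs (<⇒≢ q<m)) (<⇒≢ e<q ∘ sym))
      where
      step : x + j * (2 * e) + 2 * e ≡ x + suc j * (2 * e)
      step = solve (vars (x ∷ j ∷ e ∷ []))
      q<m : x + j * (2 * e) < m
      q<m = linear (+-mono-≤ p≤m (+-mono-≤ 0<e (z≤n {e}))) (solve (vars (x ∷ j ∷ e ∷ m ∷ [])))
      q∈xs : x + j * (2 * e) ∈ xs
      q∈xs = climb j x∈xs x≢e (<⇒≤ q<m)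
      e<q : e < x + j * (2 * e)
      e<q = <-≤-trans (e<x x∈xs x≢e) (m≤m+n x _)

    -- The last term x + i (2 e) that does not exceed m is an entry by `climb`; if it were not m,
    -- `closed` would give an entry above m.
    aligned : ∀ {x} → x ∈ xs → x ≢ e → ∃ λ i → x + i * (2 * e) ≡ m
    aligned {x} x∈xs x≢e = i , q≡m
      where
      i = (m ∸ x) / (2 * e)
      r = (m ∸ x) % (2 * e)
      q+r≡m : x + i * (2 * e) + r ≡ m
      q+r≡m = trans (trans (+-assoc x (i * (2 * e)) r) (cong (λ n → x + n) (+-comm (i * (2 * e)) r)))
                (trans (cong (λ n → x + n) (sym (m≡m%n+[m/n]*n (m ∸ x) (2 * e)))) (m+[n∸m]≡n (≤m x∈xs)))
      q≤m : x + i * (2 * e) ≤ m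
      q≤m = ≤-trans (m≤m+n _ r) (≤-reflexive q+r≡m)
      q≡m : x + i * (2 * e) ≡ m
      q≡m with x + i * (2 * e) ≟ m
      ... | yes eq  = eq
      ... | no  q≢m = contradiction (≤m (closed (∈ys (climb i x∈xs x≢e q≤m) q≢m) (<⇒≢ (<-≤-trans (e<x x∈xs x≢e) (m≤m+n x _)) ∘ sym)))
        (<⇒≱ (subst (_< x + i * (2 * e) + 2 * e) q+r≡m (+-monoʳ-< (x + i * (2 * e)) (m%n<n (m ∸ x) (2 * e)))))

    module _ (D : ℕ) (m≡ : m ≡ e + 2 * D) where

      0<D : 0 < D
      0<D = *-cancelˡ-< 2 0 D (linear (subst (e <_) m≡ e<m) (solve (vars (e ∷ D ∷ []))))

      e<e+D : e < e + D
      e<e+D = linear 0<D (solve (vars (e ∷ D ∷ [])))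

      e+D<m : e + D < m
      e+D<m = subst (e + D <_) (sym m≡) (linear 0<D (solve (vars (e ∷ D ∷ []))))

      -- Entries other than e are congruent to m modulo 2 e. Hence so are u and u + D when u is not
      -- e, and for u = e the alignment of e + D with m = e + 2 D already gives D.
      multiple : ∀ u → u ∈ ys → u + D ∈ ys → ∃ λ δ → D ≡ δ * (2 * e) × e + D ∈ xs
      multiple u u∈ys w∈ys with u ≟ e
      ... | yes refl with aligned (∈-++⁺ˡ w∈ys) (<⇒≢ e<e+D ∘ sym)
      ...   | i , eq = i , sym (linear-≡ (trans eq m≡) (solve (vars (i ∷ e ∷ D ∷ [])))) , ∈-++⁺ˡ w∈ys
      multiple u u∈ys w∈ys | no u≢e
        with aligned (∈-++⁺ˡ u∈ys) u≢e
           | aligned (∈-++⁺ˡ w∈ys) (<⇒≢ (<-≤-trans (e<x (∈-++⁺ˡ u∈ys) u≢e) (m≤m+n u D)) ∘ sym)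
      ... | i , eqᵢ | j , eqⱼ = i ∸ j , D≡ , e+D∈xs
        where
        D≡ : D ≡ (i ∸ j) * (2 * e)
        D≡ = sym (trans (*-distribʳ-∸ (2 * e) i j) (trans (cong (_∸ j * (2 * e)) i≡) (m+n∸n≡m D (j * (2 * e)))))
          where
          i≡ : i * (2 * e) ≡ D + j * (2 * e)
          i≡ = linear-≡ (trans eqᵢ (sym eqⱼ)) (solve (vars (u ∷ i ∷ j ∷ e ∷ D ∷ [])))
        reach : ∀ δ → D ≡ δ * (2 * e) → e + D ∈ xs
        reach δ D≡δ with m≤n⇒∃[o]m+o≡n {δ} {i} δ≤i
          where
          δ≤i : δ ≤ i
          δ≤i = *-cancelʳ-≤ δ i (2 * e) (linear
            (+-mono-≤ (<⇒≤ (subst (u + D <_) m≡ (<m w∈ys)))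
              (+-mono-≤ (≤-reflexive (sym D≡δ)) (≤-reflexive (sym (trans eqᵢ m≡)))))
            (solve (vars (u ∷ i ∷ δ ∷ e ∷ D ∷ []))))
        -- As i steps of 2 e lead from u to e + 2 D and δ of them make up D, the remaining l lead
        -- from u to e + D.
        ... | l , refl = subst (_∈ xs) up (climb l (∈-++⁺ˡ u∈ys) u≢e (subst (_≤ m) (sym up) (<⇒≤ e+D<m)))
          where
          up : u + l * (2 * e) ≡ e + D
          up = linear-≡ (trans eqᵢ m≡ ⊕ D≡δ) (solve (vars (u ∷ l ∷ δ ∷ e ∷ D ∷ [])))
        e+D∈xs : e + D ∈ xs
        e+D∈xs = reach (i ∸ j) D≡

      exceptional : D ≡ 1 * (2 * e) → e + D ∈ xs → Exceptional
      exceptional D≡ e+D∈xs = m≡5e , subst (_∈ xs) e+D≡3e e+D∈xs , values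
        where
        e+D≡3e : e + D ≡ 3 * e
        e+D≡3e = linear-≡ D≡ (solve (vars (e ∷ D ∷ [])))
        m≡5e : m ≡ 5 * e
        m≡5e = linear-≡ (m≡ ⊕ (D≡ ⊕ D≡)) (solve (vars (e ∷ D ∷ m ∷ [])))
        values : ∀ {x} → x ∈ ys → x ≡ e ⊎ x ≡ 3 * e
        values {x} x∈ys with x ≟ e
        ... | yes x≡e = inj₁ x≡e
        ... | no  x≢e with aligned (∈-++⁺ˡ x∈ys) x≢e
        -- Since m = 5 e, an entry i steps below m is 5 e, 3 e or e for i = 0, 1, 2, and larger i
        -- are impossible.
        ...   | 0 , eq = contradiction (trans (sym (+-identityʳ x)) eq) (<⇒≢ (<m x∈ys))
        ...   | 1 , eq = inj₂ (linear-≡ (trans eq m≡5e) (solve (vars (e ∷ x ∷ []))))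
        ...   | 2 , eq = inj₁ (linear-≡ (trans eq m≡5e) (solve (vars (e ∷ x ∷ []))))
        ...   | suc (suc (suc i)) , eq = contradiction (too-far i eq) (<⇒≱ 0<e)
          where
          too-far : ∀ i → x + (3 + i) * (2 * e) ≡ m → e ≤ 0
          too-far i eq = linear (+-mono-≤ (≤-reflexive (trans eq m≡5e)) (z≤n {x + i * (2 * e)})) (solve (vars (e ∷ x ∷ i ∷ [])))

      -- The collision is moved to the pair e, e + D. Then `g` x is x + 2 (e + D) throughout, and
      -- the lost value is 3 e + 3 D, at x = e + D. The replacement depends on whether e + D - 2 e
      -- is an entry.
      ascending : ∀ d → D ≡ (2 + d) * (2 * e) → e + D ∈ xs → Counted
      ascending d D≡ e+D∈xs = extra (e + (1 + d) * (2 * e) ∈? xs)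
        where
        open Collision D e m≡ e∈ys (∈ys e+D∈xs (<⇒≢ e+D<m))
        e+D-bad : Bad (e + D)
        e+D-bad = inj₁ (linear 0<D (solve (vars (e ∷ D ∷ []))) , refl)
        D≥4e : 4 * e ≤ D
        D≥4e = linear (+-mono-≤ (z≤n {d * (2 * e)}) (≤-reflexive (sym D≡))) (solve (vars (e ∷ d ∷ D ∷ [])))
        e+D+4e≤m : e + D + 2 * (2 * e) ≤ m
        e+D+4e≤m = subst (e + D + 2 * (2 * e) ≤_) (sym m≡) (linear D≥4e (solve (vars (e ∷ D ∷ []))))
        from-e+D : ∀ j → j ≤ 2 → e + D + j * (2 * e) ∈ xs
        from-e+D j j≤2 = climb j e+D∈xs (<⇒≢ e<e+D ∘ sym)
          (≤-trans (+-monoʳ-≤ (e + D) (*-monoˡ-≤ (2 * e) j≤2)) e+D+4e≤m)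
        g≡ : ∀ {x} → x ∈ ys → g x ≡ x + 2 * (e + D)
        g≡ {x} x∈ys with g-cases x
        ... | inj₂ (_ , eq) = eq
        ... | inj₁ (p , _)  = contradiction p (<⇒≱ (x+2e<3e+2D x∈ys))
        extra : Dec (e + (1 + d) * (2 * e) ∈ xs) → Counted
        -- The lost value itself is recovered as (e + D + 4 e) + 2 (e + D - 2 e).
        extra (yes p∈xs) = replace-bad {z = 3 * e + 3 * D} e+D-bad
          (subst (OneOmitted xs) value (oneOmitted-pair (from-e+D 2 ≤-refl) p∈xs (<⇒≢ p<q ∘ sym)) ,
           window-bound z<)
          (>m⇒∉xs (<-≤-trans m<3e+2D z≥))
          (λ {x} x∈ys x≢ eq → x≢ (linear-≡ (trans (sym (g≡ x∈ys)) eq) (solve (vars (e ∷ D ∷ x ∷ [])))))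
          where
          z< : 3 * e + 3 * D < 3 * e + 4 * D
          z< = linear 0<D (solve (vars (e ∷ D ∷ [])))
          z≥ : 3 * e + 2 * D ≤ 3 * e + 3 * D
          z≥ = linear (z≤n {D}) (solve (vars (e ∷ D ∷ [])))
          value : e + D + 2 * (2 * e) + 2 * (e + (1 + d) * (2 * e)) ≡ 3 * e + 3 * D
          value = linear-≡ (sym D≡ ⊕ sym D≡) (solve (vars (e ∷ d ∷ D ∷ [])))
          p<q : e + (1 + d) * (2 * e) < e + D + 2 * (2 * e)
          p<q = linear (+-mono-≤ (≤-reflexive (sym D≡)) (+-mono-≤ 0<e (z≤n {5 * e}))) (solve (vars (e ∷ d ∷ D ∷ [])))
        -- The replacement 7 e + 2 D is a value of `g` only at x = 5 e.
        extra (no p∉xs) = replace-bad {z = e + 2 * (e + D + 1 * (2 * e))} e+D-bad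
          (oneOmitted-pair e∈xs (from-e+D 1 (s≤s z≤n)) (<⇒≢ (<-≤-trans e<e+D (m≤m+n (e + D) _))) ,
           window-bound z<)
          (>m⇒∉xs (<-≤-trans m<3e+2D z≥))
          (λ {x} x∈ys x≢ eq → avoid d D≡ p∉xs x∈ys x≢ (linear-≡ (trans (sym (g≡ x∈ys)) eq) (solve (vars (e ∷ D ∷ x ∷ [])))))
          where
          z< : e + 2 * (e + D + 1 * (2 * e)) < 3 * e + 4 * D
          z< = linear (+-mono-≤ 0<D D≥4e) (solve (vars (e ∷ D ∷ [])))
          z≥ : 3 * e + 2 * D ≤ e + 2 * (e + D + 1 * (2 * e))
          z≥ = linear (z≤n {4 * e}) (solve (vars (e ∷ D ∷ [])))
          avoid : ∀ d → D ≡ (2 + d) * (2 * e) → e + (1 + d) * (2 * e) ∉ xs → ∀ {x} → x ∈ ys → x ≢ e + D → x ≢ 5 * e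
          -- Here D = 4 e, so 5 e is the bad element e + D.
          avoid zero D≡ _ {x} _ x≢ x≡ = x≢ (linear-≡ (x≡ ⊕ sym D≡) (solve (vars (e ∷ D ∷ x ∷ []))))
          -- Climbing from 5 e would reach e + D - 2 e, which is not an entry.
          avoid (suc d) D≡ p∉xs {x} x∈ys x≢ x≡ = p∉xs (subst (_∈ xs) up (climb d (∈-++⁺ˡ x∈ys) x≢e x+≤m))
            where
            up : x + d * (2 * e) ≡ e + (2 + d) * (2 * e)
            up = linear-≡ x≡ (solve (vars (e ∷ d ∷ x ∷ [])))
            x≢e : x ≢ e
            x≢e refl = <⇒≢ e<5e x≡
              where
              e<5e : e < 5 * e
              e<5e = linear (+-mono-≤ 0<e (z≤n {3 * e})) (solve (vars (e ∷ [])))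
            x+≤ : x + d * (2 * e) ≤ e + D
            x+≤ = linear (+-mono-≤ (≤-reflexive (x≡ ⊕ sym D≡)) (z≤n {2 * e})) (solve (vars (e ∷ d ∷ D ∷ x ∷ [])))
            x+≤m : x + d * (2 * e) ≤ m
            x+≤m = ≤-trans x+≤ (<⇒≤ e+D<m)

      conclude : ∀ u → u ∈ ys → u + D ∈ ys → Counted ⊎ Exceptional
      conclude u u∈ys w∈ys with multiple u u∈ys w∈ys
      ... | 0           , D≡ , _ = contradiction (sym D≡) (<⇒≢ 0<D)
      ... | 1           , D≡ , e+D∈xs = inj₂ (exceptional D≡ e+D∈xs)
      ... | suc (suc d) , D≡ , e+D∈xs = inj₁ (ascending d D≡ e+D∈xs)

  collision : ∀ u D → m ≡ e + 2 * D → u ∈ ys → u + D ∈ ys → Counted ⊎ Exceptional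
  collision u D m≡ u∈ys w∈ys with all? (λ x → (x ≟ e) ⊎-dec (x + 2 * e ∈? xs)) ys
  ... | yes all = Closed.conclude closed D m≡ u u∈ys w∈ys
    where
    closed : ∀ {x} → x ∈ ys → x ≢ e → x + 2 * e ∈ xs
    closed x∈ys x≢e = [ (λ x≡e → contradiction x≡e x≢e) , id ]′ (All.lookup all x∈ys)
  ... | no ¬all with find (All.¬All⇒Any¬ (λ x → (x ≟ e) ⊎-dec (x + 2 * e ∈? xs)) ys ¬all)
  ...   | x , x∈ys , ¬closed = inj₁ (Collision.missing-step D u m≡ u∈ys w∈ys x∈ys (¬closed ∘ inj₁) (¬closed ∘ inj₂))

  window : Counted ⊎ Exceptional
  window with any? (λ i → any? (λ j → m + 2 * i ≟ e + 2 * j) ys) ys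
  ... | no none = inj₁ (NoCollision.counted λ i∈ys j∈ys eq → none (lose i∈ys (lose j∈ys eq)))
  ... | yes some with find some
  ...   | u , u∈ys , some′ with find some′
  -- Since e < m, the coincidence forces u ≤ w, so D = w - u is a natural number.
  ...     | w , w∈ys , eq with m≤n⇒∃[o]m+o≡n {u} {w} (*-cancelˡ-≤ 2 (2u≤2w eq))
    where
    2u≤2w : m + 2 * u ≡ e + 2 * w → 2 * u ≤ 2 * w
    2u≤2w eq = linear (+-mono-≤ (<⇒≤ e<m) (≤-reflexive eq)) (solve (vars (e ∷ m ∷ u ∷ w ∷ [])))
  ...       | D , refl = collision u D (linear-≡ eq (solve (vars (e ∷ m ∷ u ∷ D ∷ [])))) u∈ys w∈ys

-- Scaling, and the exceptional set e, 3 e, 5 e.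

scale-take : ∀ c x y → 2 * (x * c) + y * c ≡ (2 * x + y) * c
scale-take c x y = solve (vars (x ∷ y ∷ c ∷ []))

full-scale : ∀ c {xs y} → Full xs y → Full (map (_* c) xs) (y * c)
full-scale c [] = []
full-scale c (skip f) = skip (full-scale c f)
full-scale c (take {x} {y = y} f) =
  subst (Full _) (scale-take c x y) (take (full-scale c f))

oneOmitted-scale : ∀ c {xs y} → OneOmitted xs y → OneOmitted (map (_* c) xs) (y * c)
oneOmitted-scale c (omit {x} {y = y} f) =
  subst (OneOmitted _) (sym (*-distribʳ-+ c x y)) (omit (full-scale c f))
oneOmitted-scale c (skip f) = skip (oneOmitted-scale c f)
oneOmitted-scale c (take {x} {y = y} f) =
  subst (OneOmitted _) (scale-take c x y) (take (oneOmitted-scale c f))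

-- The values are listed as a lower half followed by its reflection y ↦ 18 - y, the order in which
-- `1-3-5-attains` builds them.
1-3-5 1-3-5-values 1-3-5-7 : List ℕ
1-3-5   = 1 ∷ 3 ∷ 5 ∷ []
1-3-5-7 = 1-3-5 ∷ʳ 7
1-3-5-values = 1 ∷ 3 ∷ 5 ∷ 7 ∷ 17 ∷ 15 ∷ 13 ∷ 11 ∷ []

1-3-5-attains : All (OneOmitted 1-3-5) 1-3-5-values
1-3-5-attains = All.++⁺ lower-half (All.map⁺ (All.map oneOmitted-reflect lower-half))
  where
  lower-half : All (OneOmitted 1-3-5) (1 ∷ 3 ∷ 5 ∷ 7 ∷ [])
  lower-half = oneOmitted-single (here refl) ∷ oneOmitted-single (there (here refl)) ∷
    oneOmitted-single (there (there (here refl))) ∷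
    oneOmitted-pair (here refl) (there (here refl)) (λ ()) ∷ []

1-3-5-7-attains : AtLeast 16 (OneOmitted 1-3-5-7)
1-3-5-7-attains = atLeast values (from-yes (unique? values))
  (All.++⁺ lower-half (All.map⁺ (All.map oneOmitted-reflect lower-half))) ≤-refl
  where
  lows values : List ℕ
  lows = 1 ∷ 3 ∷ 5 ∷ 7 ∷ 9 ∷ 11 ∷ 13 ∷ 15 ∷ []
  values = lows ++ map (32 ∸_) lows
  ∈₁ : 1 ∈ 1-3-5-7
  ∈₁ = here refl
  ∈₃ : 3 ∈ 1-3-5-7
  ∈₃ = there (here refl)
  ∈₅ : 5 ∈ 1-3-5-7
  ∈₅ = there (there (here refl))
  ∈₇ : 7 ∈ 1-3-5-7
  ∈₇ = there (there (there (here refl)))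
  lower-half : All (OneOmitted 1-3-5-7) lows
  lower-half = oneOmitted-single ∈₁ ∷ oneOmitted-single ∈₃ ∷ oneOmitted-single ∈₅ ∷ oneOmitted-single ∈₇ ∷
    oneOmitted-pair ∈₇ ∈₁ (λ ()) ∷ oneOmitted-pair ∈₅ ∈₃ (λ ()) ∷ oneOmitted-pair ∈₇ ∈₃ (λ ()) ∷
    oneOmitted-pair ∈₁ ∈₇ (λ ()) ∷ []

module _ (e : ℕ) (0<e : 0 < e) where

  private
    instance
      nonZero : NonZero e
      nonZero = >-nonZero 0<e

    ys = map (_* e) 1-3-5

  atLeast-multiples : ∀ {n} {P : ℕ → Set} (ts : List ℕ) → Unique ts → n ≤ length ts →
                      (∀ {t} → t ∈ ts → P (t * e)) → AtLeast n P
  atLeast-multiples ts ts! n≤ Pts =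
    atLeast-map {P = _∈ ts} (_* e) Pts (λ {s} {t} _ _ → *-cancelʳ-≡ s t e) (atLeast ts ts! (All.tabulate id) n≤)

  module _ (m : ℕ) (m>5e : 5 * e < m) where

    -- The eight values over e , 3 e , 5 e are one short of nine, so here the window has to
    -- contribute eight values instead of seven, unless m ≡ 7 e.
    wide-window : m ≢ 7 * e → AtLeast 8 (Window e ys m)
    wide-window m≢7e with m ≤? 8 * e
    -- For m > 8 e all eight values of e, 3 e, 5 e, at most 17 e, lie in the window.
    ... | no m≰8e = atLeast-multiples 1-3-5-values (from-yes (unique? 1-3-5-values)) ≤-refl
        (λ t∈ts → oneOmitted-∷ʳ m (oneOmitted-scale e (All.lookup 1-3-5-attains t∈ts)) ,
                  bound _ (All.lookup (from-yes (all? (_≤? 17) 1-3-5-values)) t∈ts))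
      where
      below17 : 17 * e < 2 * m + e
      below17 = linear (+-mono-≤ (≰⇒> m≰8e) (<⇒≤ (≰⇒> m≰8e))) (solve (vars (e ∷ m ∷ [])))
      bound : ∀ t → t ≤ 17 → t * e < 2 * m + e
      bound t t≤17 = ≤-<-trans (*-monoˡ-≤ e t≤17) below17
    -- Otherwise the five values up to 11 e are joined by m, m + 2 e and m + 6 e.
    ... | yes m≤8e = atLeast-∪ {P = Small} {Q = Shift} proj₁ proj₁ disjoint small shifts
      where
      ts ss : List ℕ
      ts = 1 ∷ 3 ∷ 5 ∷ 7 ∷ 11 ∷ []
      ss = 0 ∷ 1 ∷ 3 ∷ []
      Small Shift : ℕ → Set
      Small z = Window e ys m z × ∃ λ t → t ∈ ts × z ≡ t * e
      Shift z = Window e ys m z × ∃ λ s → s ∈ ss × z ≡ m + 2 * (s * e)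

      small : AtLeast 5 Small
      small = atLeast-multiples ts (from-yes (unique? ts)) ≤-refl
        (λ {t} t∈ts → (oneOmitted-∷ʳ m (oneOmitted-scale e (All.lookup 1-3-5-attains (ts⊆ t∈ts))) ,
                       ≤-<-trans (*-monoˡ-≤ e (All.lookup (from-yes (all? (_≤? 11) ts)) t∈ts)) below11) ,
                      t , t∈ts , refl)
        where
        below11 : 11 * e < 2 * m + e
        below11 = linear (+-mono-≤ m>5e (<⇒≤ m>5e)) (solve (vars (e ∷ m ∷ [])))
        ts⊆ : ∀ {t} → t ∈ ts → t ∈ 1-3-5-values
        ts⊆ = All.lookup (from-yes (all? (_∈? 1-3-5-values) ts))

      shifts : AtLeast 3 Shift
      shifts = atLeast-map {P = _∈ ss} (λ s → m + 2 * (s * e))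
        (λ {s} s∈ss → (All.lookup shift-values s∈ss , bound s (All.lookup (from-yes (all? (_≤? 3) ss)) s∈ss)) , s , s∈ss , refl)
        (λ {s} {t} _ _ eq → *-cancelʳ-≡ s t e (*-cancelˡ-≡ _ _ 2 (+-cancelˡ-≡ m _ _ eq)))
        (atLeast-∈ (from-yes (unique? ss)))
        where
        m∈ : m ∈ ys ∷ʳ m
        m∈ = ∈-++⁺ʳ ys (here refl)
        m> : ∀ s → s ≤ 5 → m ≢ s * e
        m> s s≤5 = <⇒≢ (≤-<-trans (*-monoˡ-≤ e s≤5) m>5e) ∘ sym
        shift-values : All (λ s → OneOmitted (ys ∷ʳ m) (m + 2 * (s * e))) ss
        shift-values = subst (OneOmitted _) (sym (+-identityʳ m)) (oneOmitted-single m∈) ∷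
          oneOmitted-pair m∈ (here refl) (m> 1 (from-yes (1 ≤? 5))) ∷
          oneOmitted-pair m∈ (there (here refl)) (m> 3 (from-yes (3 ≤? 5))) ∷ []
        bound : ∀ s → s ≤ 3 → m + 2 * (s * e) < 2 * m + e
        bound s s≤3 = linear (+-mono-≤ m>5e (+-mono-≤ se≤3e se≤3e)) (solve (vars (e ∷ m ∷ s ∷ [])))
          where
          se≤3e : s * e ≤ 3 * e
          se≤3e = *-monoˡ-≤ e s≤3

      disjoint : ∀ {z} → Small z → ¬ Shift z
      disjoint (_ , t , t∈ts , refl) (_ , s , s∈ss , eq) =
        -- From 5 e < m ≤ 8 e a coincidence t e = m + 2 s e leaves only t = 7 + 2 s, that is m = 7
        -- e.
        m≢7e (linear-≡ (trans (sym eq) (cong (_* e) t≡)) (solve (vars (e ∷ m ∷ s ∷ []))))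
        where
        table : All (λ t → All (λ s → 5 + 2 * s < t → t ≤ 8 + 2 * s → t ≡ 7 + 2 * s) ss) ts
        table = from-yes (all? (λ t → all? (λ s → (5 + 2 * s <? t) →-dec ((t ≤? 8 + 2 * s) →-dec (t ≟ 7 + 2 * s))) ss) ts)
        lo : (5 + 2 * s) * e < t * e
        lo = linear (+-mono-≤ m>5e (≤-reflexive (sym eq))) (solve (vars (e ∷ m ∷ s ∷ t ∷ [])))
        hi : t * e ≤ (8 + 2 * s) * e
        hi = linear (+-mono-≤ m≤8e (≤-reflexive eq)) (solve (vars (e ∷ m ∷ s ∷ t ∷ [])))
        t≡ : t ≡ 7 + 2 * s
        t≡ = All.lookup (All.lookup table t∈ts) s∈ss (*-cancelʳ-< e _ t lo) (*-cancelʳ-≤ t _ e hi)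

    atLeast-exceptional : AtLeast 16 (OneOmitted (ys ∷ʳ m))
    atLeast-exceptional with m ≟ 7 * e
    ... | yes refl = atLeast-map (_* e) (oneOmitted-scale e) (λ {s} {t} _ _ → *-cancelʳ-≡ s t e) 1-3-5-7-attains
    ... | no m≢7e = atLeast-extend (All.map⁺ (All.map (λ {t} → e≤ t) (from-yes (all? (1 ≤?_) 1-3-5))))
      (atLeast-multiples 1-3-5-values (from-yes (unique? 1-3-5-values)) ≤-refl
        (oneOmitted-scale e ∘ All.lookup 1-3-5-attains))
      (wide-window m≢7e)
      where
      e≤ : ∀ t → 1 ≤ t → e ≤ t * e
      e≤ t 1≤t = subst (_≤ t * e) (*-identityˡ e) (*-monoˡ-≤ e 1≤t)

-- Induction over sorted lists.

sorted-∷ʳ⁻ : ∀ xs {m} → AllPairs _<_ (xs ∷ʳ m) → AllPairs _<_ xs × All (_< m) xs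
sorted-∷ʳ⁻ []       _ = [] , []
sorted-∷ʳ⁻ (x ∷ xs) (x< ∷ sorted) with sorted-∷ʳ⁻ xs sorted | All.∷ʳ⁻ x<
... | sorted′ , <m | x<xs , x<m = x<xs ∷ sorted′ , x<m ∷ <m

sorted-constant : ∀ {c xs} → AllPairs _<_ xs → (∀ {x} → x ∈ xs → x ≡ c) → c ∈ xs → xs ≡ [ c ]
sorted-constant {xs = x ∷ []}     _                   ≡c _ = cong [_] (≡c (here refl))
sorted-constant {xs = x ∷ y ∷ xs} ((x<y ∷ _) ∷ _) ≡c _ =
  contradiction (trans (≡c (here refl)) (sym (≡c (there (here refl))))) (<⇒≢ x<y)

-- The exceptional list is carried as an alternative; it can arise only at length three.
sorted-atLeast : ∀ {xs} → Reverse xs → AllPairs _<_ xs → All (0 <_) xs →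
  AtLeast (length xs * length xs) (OneOmitted xs) ⊎ ∃ λ e → xs ≡ map (_* e) 1-3-5
sorted-atLeast [] _ _ = inj₁ (atLeast [] [] [] z≤n)
sorted-atLeast ([] ∶ _ ∶ʳ m) _ _ =
  inj₁ (atLeast [ m ] ([] ∷ []) (oneOmitted-single (here refl) ∷ []) ≤-refl)
sorted-atLeast (ys@(e ∷ ys′) ∶ rs ∶ʳ m) sorted positive with sorted-∷ʳ⁻ ys sorted | All.++⁻ˡ ys positive
... | sorted-ys@(e<ys′ ∷ sorted-ys′) , ys<m | 0<ys@(0<e ∷ _)
    with sorted-atLeast rs sorted-ys 0<ys
-- The induction hypothesis is missing here, so the 4² = 16 numbers are exhibited directly.
... | inj₂ (c , refl) = inj₁ (atLeast-exceptional c (subst (0 <_) (*-identityˡ c) 0<e) m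
                               (All.lookup ys<m (there (there (here refl)))))
... | inj₁ small with window 0<e (here refl) (All.lookup e≤ys) (All.lookup ys<m) (AllPairs.map <⇒≢ sorted-ys)
  where
  e≤ys : All (e ≤_) ys
  e≤ys = ≤-refl ∷ All.map <⇒≤ e<ys′
... | inj₁ counted = inj₁ (subst (λ n → AtLeast n (OneOmitted (ys ∷ʳ m))) square
                            (atLeast-extend (≤-refl ∷ All.map <⇒≤ e<ys′) small counted))
  where
  square-suc : ∀ n l → l ≡ n + 1 → n * n + (l + n) ≡ l * l
  square-suc n _ refl = solve (vars (n ∷ []))
  square : length ys * length ys + (length (ys ∷ʳ m) + length ys) ≡ length (ys ∷ʳ m) * length (ys ∷ʳ m)
  square = square-suc (length ys) (length (ys ∷ʳ m)) (length-++ ys)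
... | inj₂ (m≡5e , triple∈xs , values) =
  inj₂ (e , cong₂ _∷_ (sym (*-identityˡ e)) (cong₂ _∷ʳ_ (sorted-constant sorted-ys′ ≡3e triple∈ys′) m≡5e))
  where
  ≡3e : ∀ {x} → x ∈ ys′ → x ≡ 3 * e
  ≡3e x∈ys′ with values (there x∈ys′)
  ... | inj₁ refl = contradiction refl (<⇒≢ (All.lookup e<ys′ x∈ys′))
  ... | inj₂ x≡3e = x≡3e
  e<3e : e < 3 * e
  e<3e = linear (+-mono-≤ 0<e (z≤n {e})) (solve (vars (e ∷ [])))
  triple<m : 3 * e < 5 * e
  triple<m = linear (+-mono-≤ 0<e (z≤n {e})) (solve (vars (e ∷ [])))
  triple∈ys′ : 3 * e ∈ ys′
  triple∈ys′ with ∈-++⁻ ys triple∈xs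
  ... | inj₁ (here eq)    = contradiction (sym eq) (<⇒≢ e<3e)
  ... | inj₁ (there triple∈)    = triple∈
  ... | inj₂ (here eq)    = contradiction (trans eq m≡5e) (<⇒≢ triple<m)

-- From sums with one omitted entry to the signed sumset.

∈-allSigns : ∀ {k} (v : Vec Sign k) → v ∈ allSigns k
∈-allSigns []      = here refl
∈-allSigns (s ∷ v) = ∈-concatMap⁺ _ (Any.map (λ { refl → s∷v∈ s }) (∈-allSigns v))
  where
  s∷v∈ : ∀ s → s ∷ v ∈ (neg ∷ v) ∷ (zer ∷ v) ∷ (pos ∷ v) ∷ []
  s∷v∈ neg = here refl
  s∷v∈ zer = there (here refl)
  s∷v∈ pos = there (there (here refl))

∈-sumset⁺ : ∀ {k h} (A : Vec ℤ k) v → weight v ≡ h → signedSum v A ∈ restrictedSignedSumset h A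
∈-sumset⁺ {h = h} A v w = ∈-map⁺ _ (∈-filter⁺ (λ v → weight v ≟ h) (∈-allSigns v) w)

∈-sumset⁻ : ∀ {k h z} (A : Vec ℤ k) → z ∈ restrictedSignedSumset h A → ∃ λ v → weight v ≡ h × z ≡ signedSum v A
∈-sumset⁻ {h = h} A z∈ with ∈-map⁻ _ z∈
... | v , v∈ , eq = v , proj₂ (∈-filter⁻ (λ v → weight v ≟ h) {xs = allSigns _} v∈) , eq

atLeast⇒≤card : ∀ {n xs} → AtLeast n (_∈ xs) → n ≤ card xs
atLeast⇒≤card (atLeast zs zs! zs∈ n≤) =
  ≤-trans n≤ (unique-⊆⇒length-≤ zs! (∈-deduplicate⁺ ℤ._≟_ ∘ All.lookup zs∈))

⊆⇒card≤length : ∀ xs {ys} → (∀ {z} → z ∈ xs → z ∈ ys) → card xs ≤ length ys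
⊆⇒card≤length xs xs⊆ys = unique-⊆⇒length-≤ (deduplicate-! xs) (xs⊆ys ∘ ∈-deduplicate⁻ ℤ._≟_ xs)

-- After the shift by the total, an entry a contributes 0, a or 2 a according to its sign; this and
-- the next two lemmas are the three cases.
neg-step : ∀ a s t y → s ℤ.+ t ≡ y → -[1+ 0 ] ℤ.* a ℤ.+ s ℤ.+ (a ℤ.+ t) ≡ y
neg-step a s t _ refl = identity a s t
  where
  identity : ∀ a s t → -[1+ 0 ] ℤ.* a ℤ.+ s ℤ.+ (a ℤ.+ t) ≡ s ℤ.+ t
  identity = ℤ-RingSolver.solve-∀

zer-step : ∀ a s t y → s ℤ.+ t ≡ y → + 0 ℤ.* a ℤ.+ s ℤ.+ (a ℤ.+ t) ≡ a ℤ.+ y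
zer-step a s t _ refl = identity a s t
  where
  identity : ∀ a s t → + 0 ℤ.* a ℤ.+ s ℤ.+ (a ℤ.+ t) ≡ a ℤ.+ (s ℤ.+ t)
  identity = ℤ-RingSolver.solve-∀

pos-step : ∀ a s t y → s ℤ.+ t ≡ y → + 1 ℤ.* a ℤ.+ s ℤ.+ (a ℤ.+ t) ≡ a ℤ.+ (a ℤ.+ + 0) ℤ.+ y
pos-step a s t _ refl = identity a s t
  where
  identity : ∀ a s t → + 1 ℤ.* a ℤ.+ s ℤ.+ (a ℤ.+ t) ≡ a ℤ.+ (a ℤ.+ + 0) ℤ.+ (s ℤ.+ t)
  identity = ℤ-RingSolver.solve-∀

-- The integer vector and the list of naturals are tabulated from the same function, so the two
-- descriptions recurse together.
entries : ∀ {k} → (Fin k → ℕ) → Vec ℤ k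
entries f = tabulateᵛ (+_ ∘ f)

full⇒signs : ∀ {k} (f : Fin k → ℕ) {y} → Full (tabulate f) y →
  ∃ λ v → weight v ≡ k × signedSum v (entries f) ℤ.+ + sum (tabulate f) ≡ + y
full⇒signs {zero} f [] = [] , refl , refl
full⇒signs {suc k} f (skip t) with full⇒signs (f ∘ Fin.suc) t
... | v , w , eq = neg ∷ v , cong suc w , neg-step (+ f Fin.zero) (signedSum v (entries (f ∘ Fin.suc))) _ _ eq
full⇒signs {suc k} f (take t) with full⇒signs (f ∘ Fin.suc) t
... | v , w , eq = pos ∷ v , cong suc w , pos-step (+ f Fin.zero) (signedSum v (entries (f ∘ Fin.suc))) _ _ eq

-- `omit`, `skip` and `take` become the signs 0, -1 and 1.
oneOmitted⇒signs : ∀ {k} (f : Fin k → ℕ) {y} → OneOmitted (tabulate f) y →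
  ∃ λ v → suc (weight v) ≡ k × signedSum v (entries f) ℤ.+ + sum (tabulate f) ≡ + y
oneOmitted⇒signs {suc k} f (omit t) with full⇒signs (f ∘ Fin.suc) t
... | v , w , eq = zer ∷ v , cong suc w , zer-step (+ f Fin.zero) (signedSum v (entries (f ∘ Fin.suc))) _ _ eq
oneOmitted⇒signs {suc k} f (skip t) with oneOmitted⇒signs (f ∘ Fin.suc) t
... | v , w , eq = neg ∷ v , cong suc w , neg-step (+ f Fin.zero) (signedSum v (entries (f ∘ Fin.suc))) _ _ eq
oneOmitted⇒signs {suc k} f (take t) with oneOmitted⇒signs (f ∘ Fin.suc) t
... | v , w , eq = pos ∷ v , cong suc w , pos-step (+ f Fin.zero) (signedSum v (entries (f ∘ Fin.suc))) _ _ eq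

≡-shift : ∀ {z t y} → z ℤ.+ t ≡ y → z ≡ y ℤ.- t
≡-shift {z} {t} refl = identity z t
  where
  identity : ∀ z t → z ≡ z ℤ.+ t ℤ.- t
  identity = ℤ-RingSolver.solve-∀

oneOmitted⇒∈sumset : ∀ {h} (f : Fin (suc h) → ℕ) {y} → OneOmitted (tabulate f) y →
  + y ℤ.- + sum (tabulate f) ∈ restrictedSignedSumset h (entries f)
oneOmitted⇒∈sumset f t with oneOmitted⇒signs f t
... | v , w , eq = subst (_∈ _) (≡-shift eq) (∈-sumset⁺ (entries f) v (suc-injective w))

suc-square : ∀ h → suc h * suc h ≡ h * h + 2 * h + 1
suc-square h = solve (vars (h ∷ []))

lower-bound : ∀ {h} → 3 ≤ h → (f : Fin (suc h) → ℕ) → (∀ i → 0 < f i) → (∀ {i j} → i <F j → f i < f j) →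
  h * h + 2 * h + 1 ≤ card (restrictedSignedSumset h (entries f))
lower-bound {h} 3≤h f positive increasing
  with sorted-atLeast (reverseView (tabulate f)) (AllPairs.tabulate⁺-< increasing) (All.tabulate⁺ positive)
-- The exceptional list has three entries, whereas h + 1 is at least four.
... | inj₂ (e , eq) = contradiction (trans (sym (length-tabulate f)) (cong length eq)) (<⇒≢ (s≤s 3≤h) ∘ sym)
... | inj₁ many = ≤-trans
  (≤-reflexive (sym (trans (cong₂ _*_ (length-tabulate f) (length-tabulate f)) (suc-square h))))
  (atLeast⇒≤card (atLeast-map (λ y → + y ℤ.- + sum (tabulate f)) (oneOmitted⇒∈sumset f)
    (λ {x} {y} _ _ eq → ℤ.+-injective (∙-cancelʳ ℤ.+-0-abelianGroup (ℤ.- + sum (tabulate f)) (+ x) (+ y) eq)) many))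

entries-∣∣ : ∀ {k} (A : Vec ℤ k) → (∀ i → + 0 <ℤ lookup A i) → entries (∣_∣ ∘ lookup A) ≡ A
entries-∣∣ []      _        = refl
entries-∣∣ (a ∷ A) positive =
  cong₂ _∷_ (ℤ.0≤i⇒+∣i∣≡i (ℤ.<⇒≤ (positive Fin.zero))) (entries-∣∣ A (positive ∘ Fin.suc))

-- Sharpness: sets of odd numbers.

-- General b is used because the recursions pass to b ∘ Fin.suc; the extremal set 1, 3, 5, ... is b
-- = toℕ.
odd : ∀ {k} → (Fin k → ℕ) → Fin k → ℕ
odd b i = suc (2 * b i)

weight≤k : ∀ {k} (v : Vec Sign k) → weight v ≤ k
weight≤k []        = z≤n
weight≤k (neg ∷ v) = s≤s (weight≤k v)
weight≤k (zer ∷ v) = m≤n⇒m≤1+n (weight≤k v)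
weight≤k (pos ∷ v) = s≤s (weight≤k v)

-- Here q is the sum of the entries with sign +.
full-range : ∀ {k} (b : Fin k → ℕ) v → weight v ≡ k → ∃ λ q → q ≤ sum (tabulate (odd b)) ×
  signedSum v (entries (odd b)) ℤ.+ + sum (tabulate (odd b)) ≡ + (2 * q)
full-range {zero} b [] _ = 0 , z≤n , refl
full-range {suc k} b (zer ∷ v) w = contradiction w (<⇒≢ (s≤s (weight≤k v)))
full-range {suc k} b (neg ∷ v) w with full-range (b ∘ Fin.suc) v (suc-injective w)
... | q , q≤ , eq = q , m≤n⇒m≤o+n (odd b Fin.zero) q≤ ,
  neg-step (+ odd b Fin.zero) (signedSum v (entries (odd (b ∘ Fin.suc)))) _ _ eq
full-range {suc k} b (pos ∷ v) w with full-range (b ∘ Fin.suc) v (suc-injective w)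
... | q , q≤ , eq = odd b Fin.zero + q , +-monoʳ-≤ (odd b Fin.zero) q≤ ,
  trans (pos-step (+ odd b Fin.zero) (signedSum v (entries (odd (b ∘ Fin.suc)))) _ _ eq)
    (cong +_ (sym (*-distribˡ-+ 2 (odd b Fin.zero) q)))

-- The omitted odd entry makes the shifted sum odd, so it is determined by t, which takes at most as
-- many values as the total of the entries.
oneOmitted-range : ∀ {k} (b : Fin k → ℕ) v → suc (weight v) ≡ k → ∃ λ t → t < sum (tabulate (odd b)) ×
  signedSum v (entries (odd b)) ℤ.+ + sum (tabulate (odd b)) ≡ + suc (2 * t)
oneOmitted-range {suc k} b (zer ∷ v) w with full-range (b ∘ Fin.suc) v (suc-injective w)
... | q , q≤ , eq = b Fin.zero + q , s≤s (+-mono-≤ (m≤m+n (b Fin.zero) _) q≤) ,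
  trans (zer-step (+ odd b Fin.zero) (signedSum v (entries (odd (b ∘ Fin.suc)))) _ _ eq)
    (cong (+_ ∘ suc) (sym (*-distribˡ-+ 2 (b Fin.zero) q)))
oneOmitted-range {suc k} b (neg ∷ v) w with oneOmitted-range (b ∘ Fin.suc) v (suc-injective w)
... | t , t< , eq = t , m≤n⇒m≤o+n (odd b Fin.zero) t< ,
  neg-step (+ odd b Fin.zero) (signedSum v (entries (odd (b ∘ Fin.suc)))) _ _ eq
oneOmitted-range {suc k} b (pos ∷ v) w with oneOmitted-range (b ∘ Fin.suc) v (suc-injective w)
... | t , t< , eq = odd b Fin.zero + t , +-monoʳ-< (odd b Fin.zero) t< ,
  trans (pos-step (+ odd b Fin.zero) (signedSum v (entries (odd (b ∘ Fin.suc)))) _ _ eq)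
    (cong +_ (odd-double (odd b Fin.zero) t))
  where
  odd-double : ∀ a t → 2 * a + suc (2 * t) ≡ suc (2 * (a + t))
  odd-double a t = solve (vars (a ∷ t ∷ []))

card-odd≤ : ∀ {h} (b : Fin (suc h) → ℕ) → card (restrictedSignedSumset h (entries (odd b))) ≤ sum (tabulate (odd b))
card-odd≤ {h} b = ≤-trans (⊆⇒card≤length (restrictedSignedSumset h (entries (odd b))) covered)
  (≤-reflexive (trans (length-map value (upTo S)) (length-upTo S)))
  where
  S = sum (tabulate (odd b))
  value : ℕ → ℤ
  value t = + suc (2 * t) ℤ.- + S
  covered : ∀ {z} → z ∈ restrictedSignedSumset h (entries (odd b)) → z ∈ map value (upTo S)
  covered z∈ with ∈-sumset⁻ (entries (odd b)) z∈
  ... | v , w , refl with oneOmitted-range b v (cong suc w)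
  ...   | t , t<S , eq = subst (_∈ map value (upTo S)) (sym (≡-shift eq)) (∈-map⁺ value (∈-upTo⁺ t<S))

-- The offset c serves the induction: removing the first entry raises it by one.
sum-odd : ∀ k c → sum (tabulate {n = k} (odd (λ i → c + toℕ i))) ≡ k * k + 2 * c * k
sum-odd zero    c = sym (*-zeroʳ (2 * c))
sum-odd (suc k) c = trans (cong (λ xs → suc (2 * (c + 0)) + sum xs)
    (tabulate-cong {n = k} (λ i → cong (suc ∘ (2 *_)) (+-suc c (toℕ i)))))
  (trans (cong (λ s → suc (2 * (c + 0)) + s) (sum-odd k (suc c))) (step k c))
  where
  step : ∀ k c → suc (2 * (c + 0)) + (k * k + 2 * suc c * k) ≡ suc k * suc k + 2 * c * suc k
  step k c = solve (vars (k ∷ c ∷ []))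

sum-odd-toℕ : ∀ h → sum (tabulate {n = suc h} (odd toℕ)) ≡ h * h + 2 * h + 1
sum-odd-toℕ h = trans (sum-odd (suc h) 0) (trans (+-identityʳ _) (suc-square h))

theorem5 : (∀ (h : ℕ) → 3 ≤ h → (A : Vec ℤ (suc h))
    → (∀ i → + 0 <ℤ lookup A i)
    → (∀ i j → i <F j → lookup A i <ℤ lookup A j)
    → h * h + 2 * h + 1 ≤ card (restrictedSignedSumset h A))
    × (∀ (h : ℕ) → 3 ≤ h → ∃ λ (A : Vec ℤ (suc h))
    → (∀ i → + 0 <ℤ lookup A i)
    × (∀ i j → i <F j → lookup A i <ℤ lookup A j)
    × card (restrictedSignedSumset h A) ≡ h * h + 2 * h + 1)
theorem5 = bound , sharp
  where
  bound : ∀ h → 3 ≤ h → (A : Vec ℤ (suc h)) → (∀ i → + 0 <ℤ lookup A i) →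
    (∀ i j → i <F j → lookup A i <ℤ lookup A j) → h * h + 2 * h + 1 ≤ card (restrictedSignedSumset h A)
  bound h 3≤h A positive increasing = subst (λ B → h * h + 2 * h + 1 ≤ card (restrictedSignedSumset h B))
    (entries-∣∣ A positive)
    (lower-bound 3≤h (∣_∣ ∘ lookup A) (λ i → ℤ.drop‿+<+ (subst (+ 0 <ℤ_) (sym (abs i)) (positive i)))
      (λ {i} {j} i<j → ℤ.drop‿+<+ (subst₂ _<ℤ_ (sym (abs i)) (sym (abs j)) (increasing i j i<j))))
    where
    abs : ∀ i → + ∣ lookup A i ∣ ≡ lookup A i
    abs i = ℤ.0≤i⇒+∣i∣≡i (ℤ.<⇒≤ (positive i))

  sharp : ∀ h → 3 ≤ h → ∃ λ (A : Vec ℤ (suc h)) → (∀ i → + 0 <ℤ lookup A i) ×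
    (∀ i j → i <F j → lookup A i <ℤ lookup A j) × card (restrictedSignedSumset h A) ≡ h * h + 2 * h + 1
  sharp h 3≤h = entries (odd toℕ) ,
    (λ i → subst (+ 0 <ℤ_) (sym (entry i)) (+<+ (s≤s z≤n))) ,
    (λ i j i<j → subst₂ _<ℤ_ (sym (entry i)) (sym (entry j)) (+<+ (increasing i<j))) ,
    ≤-antisym (≤-trans (card-odd≤ {h} toℕ) (≤-reflexive (sum-odd-toℕ h)))
      (lower-bound 3≤h (odd toℕ) (λ _ → s≤s z≤n) increasing)
    where
    entry : ∀ i → lookup (entries (odd toℕ)) i ≡ + odd toℕ i
    entry = lookup∘tabulate (+_ ∘ odd toℕ)
    increasing : ∀ {i j : Fin (suc h)} → i <F j → odd toℕ i < odd toℕ j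
    increasing i<j = s≤s (*-monoʳ-< 2 i<j)
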